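{- Let $\vec{G_0}$ be a difference distance magic oriented graph (DDMOG) with $n$ vertices, and let $s\in\{2,3,4,5,6\}$. Let $L$ be an integer such that $a_s\le L\le b_s$, where the bounds $a_s$, $b_s$ and the associated list of node labels are: - $s=2$: $a_2=3$, $b_2=n+2$; node labels $2,\ L-2$. - $s=3$: $a_3=6$, $b_3=n+5$; node labels $4,\ L-5,\ L-3$; in this case $L$ is additionally assumed to be even. - $s=4$: $a_4=6$, $b_4=n+2$; node labels $1,\ 2,\ 3,\ L-2$. - $s=5$: $a_5=7$, $b_5=n+3$; node labels $1,\ 2,\ 3,\ L-3,\ L-2$. - $s=6$: $a_6=8$, $b_6=n+3$; node labels $1,\ 2,\ 3,\ 4,\ L-3,\ L-2$. Let $H=4C_L$ be the disjoint union of four cycles of length $L$. Then there exists an orientation $\vec{H}$ of $H$, paired with a labeling function $h$, such that (a) the oriented graph $\vec{H}$ is an $s$-nodes ornament, where the labels of the nodes are as listed above for the given $s$; and (b) the weighted sum $\vec{G}:=\vec{G_0}\oplus_{\mathrm{wt}_h}\vec{H}$ is a DDMOG.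
   Context: All graphs are finite and simple. An oriented graph is a directed graph in which $(u,v)$ being an edge implies that $(v,u)$ is not an edge; an orientation of an undirected graph is an oriented graph whose underlying graph is that graph. Oriented cycles are always such that every vertex has exactly one incoming and one outgoing edge (different copies of a cycle may be oriented oppositely). **Labeling and weight.** A labeling function of a graph is a bijection from its vertex set onto some set of integers. For an oriented graph with labeling function $f$, the weight of a vertex $x$ is $\mathrm{wt}_f(x)=\sum_{y:\,(y,x)\text{ is an edge}} f(y)-\sum_{y:\,(x,y)\text{ is an edge}} f(y)$. **DDMOG.** A difference distance magic (DDM) labeling of an oriented graph $\vec G$ on $n$ vertices is a bijection $f:V(\vec G)\to\{1,\dots,n\}$ such that $\mathrm{wt}_f(x)$ has the same value for all vertices $x$ (this value is then necessarily $0$). An oriented graph that has a DDM labeling is called a difference distance magic oriented graph (DDMOG). Edgeless graphs are trivial examples. **Weighted sum.** Let $\vec G$ be an oriented graph with vertices $v_1,\dots,v_n$ and labeling $g(v_i)=i$ (for a DDMOG, its DDM labeling), and let $\vec H$ be a separate oriented graph with labeling $h:V(\vec H)\to\mathbb{Z}^+$ such that $\{|\mathrm{wt}_h(u)|:u\in V(\vec H)\}\subseteq\{0\}\cup\{g(v):v\in V(\vec G)\}$. The weighted sum $\vec G\oplus_{\mathrm{wt}_h}\vec H$ is the oriented graph with vertex set $V(\vec G)\cup V(\vec H)$ whose edges are those of $\vec G$ and of $\vec H$ together with, for each $1\le i\le n$, all edges $(v_i,u)$ with $u\in V(\vec H)$, $\mathrm{wt}_h(u)=-i$, and all edges $(u,v_i)$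 with $u\in V(\vec H)$, $\mathrm{wt}_h(u)=i$. **Ornaments and nodes.** For two separate graphs $\vec G$ and $\vec H$, $\vec H$ is attached to $\vec G$ when one or more oriented edges are introduced between some vertices of $\vec G$ and some vertices of $\vec H$. A vertex of $\vec G$ that has multiple vertices of $\vec H$ attached to it is called a node. An ornament $\vec H$ is an oriented graph that can be attached to a DDMOG $\vec G$ in such a way that the resulting graph has a DDM labeling, while preserving the initial DDM labeling of $\vec G$. If $s$ vertices of the DDMOG $\vec G$ are to be attached to multiple vertices of the ornament $\vec H$, then $\vec H$ is called an $s$-nodes ornament. The label of a node is its label under the DDM labeling of $\vec G$.
   Formalization: The listed node labels are additionally assumed to be labels of vertices of G_0 (the stated bounds allow e.g. L-3=n+2 for s=3 and L-2=n+1 for s=5,6, where (a) is impossible); for s=2, L=4, where 2=L-2, the ornament has the single node labelled 2. -}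

module Defs where

open import Level using (0ℓ)
open import Data.Bool using (if_then_else_)
open import Data.Empty using (⊥)
open import Data.Nat as ℕ using (ℕ; suc; s≤s; z≤n)
import Data.Nat.Properties as ℕ
open import Data.Nat.Divisibility using (_∣_)
open import Data.Integer using (ℤ; +_; 0ℤ; 1ℤ; -_; _-_; _≤_; _<_; ∣_∣; _≟_)
import Data.Integer.Properties as ℤ
open import Data.Fin as Fin using (Fin; toℕ)
import Data.Fin.Properties as Fin
open import Data.Vec using (Vec; []; _∷_; lookup)
open import Data.Product using (∃-syntax; ∃!; _×_; _,_; proj₁; proj₂)
open import Data.Product.Function.NonDependent.Propositional using (_×-↔_)
open import Data.Sum using (_⊎_; inj₁; inj₂; swap)
open import Data.Sum.Function.Propositional using (_⊎-↔_)
open import Function.Bundles using (_↔_; _⇔_; Inverse; Equivalence)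
open import Function.Construct.Composition using (_↔-∘_)
open import Function.Construct.Identity using (↔-id)
open import Function.Construct.Symmetry using (↔-sym)
open import Function.Definitions using (Injective)
open import Relation.Binary using (Rel; REL; Decidable; Symmetric; Asymmetric; Irreflexive)
open import Relation.Binary.PropositionalEquality
open import Relation.Nullary using (¬_; Dec; does)
open import Relation.Nullary.Decidable using (_×-dec_; _⊎-dec_)
open import Algebra.Properties.CommutativeMonoid.Sum ℤ.+-0-commutativeMonoid using (sum)

record Graph : Set₁ where
  field
    Vertex      : Set
    order       : ℕ
    enumeration : Vertex ↔ Fin order
    Adjacent    : Rel Vertex 0ℓ
    adjacent?   : Decidable Adjacent
    symmetric   : Symmetric Adjacent
    irreflexive : Irreflexive _≡_ Adjacent

-- Asymmetry also rules out loops.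
record OrientedGraph : Set₁ where
  field
    Vertex      : Set
    order       : ℕ
    enumeration : Vertex ↔ Fin order
    Edge        : Rel Vertex 0ℓ
    edge?       : Decidable Edge
    asymmetric  : Asymmetric Edge

  vertex : Fin order → Vertex
  vertex = Inverse.from enumeration

open OrientedGraph public

record Orientation (G : Graph) : Set₁ where
  private module G = Graph G
  field
    Arc        : Rel G.Vertex 0ℓ
    arc?       : Decidable Arc
    arc-asym   : Asymmetric Arc
    underlying : ∀ x y → G.Adjacent x y ⇔ (Arc x y ⊎ Arc y x)

  oriented : OrientedGraph
  oriented = record
    { Vertex = G.Vertex ; order = G.order ; enumeration = G.enumeration
    ; Edge = Arc ; edge? = arc? ; asymmetric = arc-asym }

open Orientation public using (oriented)

ConsistentlyOriented : OrientedGraph → Set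
ConsistentlyOriented G =
  ∀ x → ∃! _≡_ (λ y → Edge G y x) × ∃! _≡_ (λ y → Edge G x y)

-- Cyclic successor on Fin L.
Next : ∀ {L} → Rel (Fin L) 0ℓ
Next {L} i j = (suc (toℕ i) ≡ toℕ j) ⊎ (suc (toℕ i) ≡ L × toℕ j ≡ 0)

next? : ∀ {L} → Decidable (Next {L})
next? {L} i j =
  (suc (toℕ i) ℕ.≟ toℕ j) ⊎-dec ((suc (toℕ i) ℕ.≟ L) ×-dec (toℕ j ℕ.≟ 0))

next-irreflexive : ∀ {L} → 3 ℕ.≤ L → Irreflexive _≡_ (Next {L})
next-irreflexive 3≤L refl (inj₁ p) = ℕ.1+n≢n p
next-irreflexive {L} 3≤L {i} refl (inj₂ (p , q)) = absurd (subst (3 ℕ.≤_) L≡1 3≤L)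
  where
  L≡1 : L ≡ 1
  L≡1 = trans (sym p) (cong suc q)

  absurd : ¬ (3 ℕ.≤ 1)
  absurd (s≤s ())

cycle : (L : ℕ) → 3 ℕ.≤ L → Graph
cycle L 3≤L = record
  { Vertex      = Fin L
  ; order       = L
  ; enumeration = ↔-id (Fin L)
  ; Adjacent    = λ i j → Next i j ⊎ Next j i
  ; adjacent?   = λ i j → next? i j ⊎-dec next? j i
  ; symmetric   = swap
  ; irreflexive = λ { e (inj₁ p) → next-irreflexive 3≤L e p
                      ; e (inj₂ p) → next-irreflexive 3≤L (sym e) p }
  }

-- The disjoint union of k copies of G.
copies : ℕ → Graph → Graph
copies k G = record
  { Vertex      = Fin k × G.Vertex
  ; order       = k ℕ.* G.order
  ; enumeration = ↔-sym Fin.*↔× ↔-∘ (↔-id (Fin k) ×-↔ G.enumeration)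
  ; Adjacent    = λ (i , x) (j , y) → i ≡ j × G.Adjacent x y
  ; adjacent?   = λ (i , x) (j , y) → (i Fin.≟ j) ×-dec G.adjacent? x y
  ; symmetric   = λ (e , a) → sym e , G.symmetric a
  ; irreflexive = λ { refl (_ , a) → G.irreflexive refl a }
  }
  where module G = Graph G

sumOver : (G : OrientedGraph) {P : Vertex G → Set} →
          (∀ y → Dec (P y)) → (Vertex G → ℤ) → ℤ
sumOver G P? f =
  sum (λ i → if does (P? (vertex G i)) then f (vertex G i) else 0ℤ)

wt : (G : OrientedGraph) → (Vertex G → ℤ) → Vertex G → ℤ
wt G f x = sumOver G (λ y → edge? G y x) f - sumOver G (λ y → edge? G x y) f

-- A bijection from the vertex set onto some set of integers
-- is the same thing as an injection into ℤ.
IsLabeling : (G : OrientedGraph) → (Vertex G → ℤ) → Set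
IsLabeling G f = Injective _≡_ _≡_ f

IsPositiveLabeling : (G : OrientedGraph) → (Vertex G → ℤ) → Set
IsPositiveLabeling G h = IsLabeling G h × (∀ u → 0ℤ < h u)

-- A bijection from the vertex set onto {1,…,n}, where n is the order.
record IsStandardLabeling (G : OrientedGraph) (f : Vertex G → ℤ) : Set where
  field
    injective : IsLabeling G f
    image     : ∀ k → (∃[ v ] f v ≡ k) ⇔ (1ℤ ≤ k × k ≤ + order G)

record IsDDMLabeling (G : OrientedGraph) (f : Vertex G → ℤ) : Set where
  field
    standard : IsStandardLabeling G f
    constant : ∀ x y → wt G f x ≡ wt G f y

IsDDMOG : OrientedGraph → Set
IsDDMOG G = ∃[ f ] IsDDMLabeling G f

-- A choice of oriented edges between the vertices of G and those of H.
record Connection (G H : OrientedGraph) : Set₁ where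
  field
    To       : REL (Vertex G) (Vertex H) 0ℓ
    From     : REL (Vertex H) (Vertex G) 0ℓ
    to?      : Decidable To
    from?    : Decidable From
    disjoint : ∀ {v u} → To v u → From u v → ⊥

  Attached : REL (Vertex G) (Vertex H) 0ℓ
  Attached v u = To v u ⊎ From u v

  IsAttachment : Set
  IsAttachment = ∃[ v ] ∃[ u ] Attached v u

  IsNode : Vertex G → Set
  IsNode v = ∃[ u ] ∃[ u′ ] u ≢ u′ × Attached v u × Attached v u′

open Connection public

join : (G H : OrientedGraph) → Connection G H → OrientedGraph
join G H C = record
  { Vertex      = Vertex G ⊎ Vertex H
  ; order       = order G ℕ.+ order H
  ; enumeration = ↔-sym Fin.+↔⊎ ↔-∘ (enumeration G ⊎-↔ enumeration H)
  ; Edge        = E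
  ; edge?       = E?
  ; asymmetric  = λ {x} {y} → E-asym x y
  }
  where
  E : Rel (Vertex G ⊎ Vertex H) 0ℓ
  E (inj₁ v) (inj₁ v′) = Edge G v v′
  E (inj₁ v) (inj₂ u)  = To C v u
  E (inj₂ u) (inj₁ v)  = From C u v
  E (inj₂ u) (inj₂ u′) = Edge H u u′

  E? : Decidable E
  E? (inj₁ v) (inj₁ v′) = edge? G v v′
  E? (inj₁ v) (inj₂ u)  = to? C v u
  E? (inj₂ u) (inj₁ v)  = from? C u v
  E? (inj₂ u) (inj₂ u′) = edge? H u u′

  E-asym : ∀ x y → E x y → E y x → ⊥
  E-asym (inj₁ v) (inj₁ v′) = asymmetric G
  E-asym (inj₁ v) (inj₂ u)  = disjoint C
  E-asym (inj₂ u) (inj₁ v)  = λ f t → disjoint C t f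
  E-asym (inj₂ u) (inj₂ u′) = asymmetric H

-- H is an s-nodes ornament for the DDMOG G with DDM labeling g, the labels of
-- the s nodes being the entries of ℓ.
record IsNodesOrnament (G : OrientedGraph) (g : Vertex G → ℤ) (H : OrientedGraph)
                       (s : ℕ) (ℓ : Vec ℤ s) : Set₁ where
  field
    connection : Connection G H
    attachment : IsAttachment connection
    labeling   : Vertex G ⊎ Vertex H → ℤ
    ddm        : IsDDMLabeling (join G H connection) labeling
    preserves  : ∀ v → labeling (inj₁ v) ≡ g v
    node       : Fin s → Vertex G
    node-injective : Injective _≡_ _≡_ node
    isNode     : ∀ v → IsNode connection v ⇔ (∃[ i ] node i ≡ v)
    node-label : ∀ i → g (node i) ≡ lookup ℓ i

-- {|wt_h(u)| : u ∈ V(H)} ⊆ {0} ∪ {g(v) : v ∈ V(G)}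
WeightsAmongLabels : (G : OrientedGraph) (g : Vertex G → ℤ)
                     (H : OrientedGraph) (h : Vertex H → ℤ) → Set
WeightsAmongLabels G g H h =
  ∀ u → (+ ∣ wt H h u ∣ ≡ 0ℤ) ⊎ (∃[ v ] + ∣ wt H h u ∣ ≡ g v)

weightConnection : (G : OrientedGraph) {g : Vertex G → ℤ} → IsStandardLabeling G g →
                   (H : OrientedGraph) (h : Vertex H → ℤ) → Connection G H
weightConnection G {g} std H h = record
  { To       = λ v u → wt H h u ≡ - g v
  ; From     = λ u v → wt H h u ≡ g v
  ; to?      = λ v u → wt H h u ≟ - g v
  ; from?    = λ u v → wt H h u ≟ g v
  ; disjoint = λ {v} p q → -k≢k (proj₁ (Equivalence.to (image std (g v)) (v , refl)))
                                (trans (sym p) q)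
  }
  where
  open IsStandardLabeling

  -k≢k : ∀ {k} → 1ℤ ≤ k → - k ≢ k
  -k≢k {+ suc _} _ ()
  -k≢k {+ 0} (_≤_.+≤+ ()) _

weightedSum : (G : OrientedGraph) {g : Vertex G → ℤ} → IsStandardLabeling G g →
              (H : OrientedGraph) {h : Vertex H → ℤ} → IsPositiveLabeling H h →
              WeightsAmongLabels G g H h → OrientedGraph
weightedSum G std H {h} _ _ = join G H (weightConnection G std H h)

-- Parameters n L s ℓ: for a DDMOG on n vertices, cycle length L is admitted for
-- s nodes, and ℓ lists their labels.  The labels 2 and L − 2 coincide when
-- L = 4, and distinct nodes have distinct labels, so that instance of the
-- two-node family has a single node and is kept apart as two₄.
data Parameters (n L : ℕ) : (s : ℕ) → Vec ℤ s → Set where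
  two   : 3 ℕ.≤ L → L ℕ.≤ n ℕ.+ 2 → L ≢ 4 →
          Parameters n L 2 (+ 2 ∷ + L - + 2 ∷ [])
  two₄  : L ≡ 4 → L ℕ.≤ n ℕ.+ 2 →
          Parameters n L 1 (+ 2 ∷ [])
  three : 6 ℕ.≤ L → L ℕ.≤ n ℕ.+ 5 → 2 ∣ L →
          Parameters n L 3 (+ 4 ∷ + L - + 5 ∷ + L - + 3 ∷ [])
  four  : 6 ℕ.≤ L → L ℕ.≤ n ℕ.+ 2 →
          Parameters n L 4 (+ 1 ∷ + 2 ∷ + 3 ∷ + L - + 2 ∷ [])
  five  : 7 ℕ.≤ L → L ℕ.≤ n ℕ.+ 3 →
          Parameters n L 5 (+ 1 ∷ + 2 ∷ + 3 ∷ + L - + 3 ∷ + L - + 2 ∷ [])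
  six   : 8 ℕ.≤ L → L ℕ.≤ n ℕ.+ 3 →
          Parameters n L 6 (+ 1 ∷ + 2 ∷ + 3 ∷ + 4 ∷ + L - + 3 ∷ + L - + 2 ∷ [])

3≤L : ∀ {n L s ℓ} → Parameters n L s ℓ → 3 ℕ.≤ L
3≤L (two p _ _)   = p
3≤L (two₄ refl _) = s≤s (s≤s (s≤s z≤n))
3≤L (three p _ _) = ℕ.≤-trans (s≤s (s≤s (s≤s z≤n))) p
3≤L (four p _)    = ℕ.≤-trans (s≤s (s≤s (s≤s z≤n))) p
3≤L (five p _)    = ℕ.≤-trans (s≤s (s≤s (s≤s z≤n))) p
3≤L (six p _)     = ℕ.≤-trans (s≤s (s≤s (s≤s z≤n))) p

-- Every listed label is the label of a vertex of G.  The bounds on L alone do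
-- not guarantee this: they admit L − 3 = n + 2 for three nodes, L − 2 = n + 1
-- for five and six nodes, and very small n with 2 > n or 4 > n.
LabelsOccur : (G : OrientedGraph) (g : Vertex G → ℤ) {s : ℕ} → Vec ℤ s → Set
LabelsOccur G g ℓ = ∀ i → ∃[ v ] g v ≡ lookup ℓ i

{-# OPTIONS --safe #-}

-- In a directed cycle the weight of a vertex is the difference of the labels of
-- its two neighbours, so it suffices to arrange 0, …, L − 1 around one cycle such
-- that entries two apart differ exactly by the prescribed node labels.  With n the
-- order of G₀, copy k = 0, …, 3 of the cycle carries this arrangement shifted by
-- n + 1 + kL, and copies 1 and 2 are reversed.  At a node the four copies of a
-- vertex then contribute ±(c + kL) with signs + − − + (or all opposite), which add
-- up to 0 for every c.  A vertex of a cycle is balanced by the single node that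
-- carries the absolute value of its weight.
module Submission where

open import Defs
open import Data.Bool using (Bool; true; false; if_then_else_)
open import Data.Empty using (⊥-elim)
open import Data.Nat as ℕ using (ℕ; zero; suc; z≤n; s≤s)
import Data.Nat.Properties as ℕ
open import Data.Nat.Divisibility using (divides)
open import Data.Nat.Tactic.RingSolver using () renaming (solve-∀ to solveℕ-∀)
open import Data.Integer using (ℤ; +_; +[1+_]; 0ℤ; 1ℤ; _+_; _*_; -_; _-_; _≤_; _<_; ∣_∣; _≟_; _⊖_; +≤+; +<+)
import Data.Integer.Properties as ℤ
open import Data.Integer.Tactic.RingSolver using (solve-∀)
open import Data.Fin as Fin using (Fin; zero; suc; toℕ; fromℕ<; splitAt; remQuot; combine)
open import Data.Fin.Patterns using (0F; 1F; 2F; 3F; 4F; 5F)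
import Data.Fin.Properties as Fin
open import Data.Vec using (Vec; []; _∷_; lookup)
open import Data.Vec.Relation.Unary.All using ([]; _∷_)
open import Data.Vec.Relation.Unary.AllPairs using ([]; _∷_)
open import Data.Vec.Relation.Unary.Unique.Propositional using (Unique)
open import Data.Vec.Relation.Unary.Unique.Propositional.Properties using (lookup-injective)
open import Data.Product as Product using (Σ-syntax; ∃-syntax; ∃₂; _×_; _,_; proj₁; proj₂)
open import Data.Sum as Sum using (_⊎_; inj₁; inj₂; [_,_]′)
open import Function using (_∘_; id)
open import Function.Bundles using (_⇔_; mk⇔; Inverse; Equivalence)
open import Function.Definitions using (Injective)
open import Relation.Binary using (Rel)
open import Relation.Binary.PropositionalEquality
open import Relation.Nullary using (¬_; Dec; yes; no; does; contradiction)
open import Relation.Nullary.Decidable using (dec-true; dec-false; _×-dec_)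
open import Algebra.Properties.CommutativeMonoid.Sum ℤ.+-0-commutativeMonoid
  using (sum; sum-cong-≗; sum-remove; sum-replicate-zero; ∑-comm; ∑-distrib-+)
import Algebra.Properties.Semiring.Sum as SemiringSum
open SemiringSum ℤ.+-*-semiring using (*-distribˡ-sum; *-distribʳ-sum)
open import Algebra.Properties.AbelianGroup ℤ.+-0-abelianGroup using (∙-cancelˡ)

open IsStandardLabeling
open IsDDMLabeling

-- Finite sums

sum-zero : ∀ {n} (t : Fin n → ℤ) → (∀ i → t i ≡ 0ℤ) → sum t ≡ 0ℤ
sum-zero {n} t t≡0 = trans (sum-cong-≗ t≡0) (sum-replicate-zero n)

sum-single : ∀ {n} (t : Fin n → ℤ) i → (∀ j → j ≢ i → t j ≡ 0ℤ) → sum t ≡ t i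
sum-single {suc n} t i t≡0 = begin
  sum t            ≡⟨ sum-remove t ⟩
  t i + sum rest   ≡⟨ cong (_+_ (t i)) (sum-zero rest λ j → t≡0 _ (Fin.punchInᵢ≢i i j)) ⟩
  t i + 0ℤ         ≡⟨ ℤ.+-identityʳ (t i) ⟩
  t i              ∎
  where
  open ≡-Reasoning
  rest = λ j → t (Fin.punchIn i j)

sum-nonneg : ∀ {n} (t : Fin n → ℤ) → (∀ i → 0ℤ ≤ t i) → 0ℤ ≤ sum t
sum-nonneg {zero}  t 0≤t = ℤ.≤-refl
sum-nonneg {suc n} t 0≤t = ℤ.+-mono-≤ (0≤t zero) (sum-nonneg (t ∘ suc) (0≤t ∘ suc))

sum-splitAt : ∀ m {n} (t : Fin m ⊎ Fin n → ℤ) →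
              sum (t ∘ splitAt m) ≡ sum (t ∘ inj₁) + sum (t ∘ inj₂)
sum-splitAt zero    t = sym (ℤ.+-identityˡ _)
sum-splitAt (suc m) t = begin
  t₀ + sum (t ∘ Sum.map suc id ∘ splitAt m)
    ≡⟨ cong (_+_ t₀) (sum-splitAt m (t ∘ Sum.map suc id)) ⟩
  t₀ + (sum (t ∘ inj₁ ∘ suc) + sum (t ∘ inj₂))
    ≡⟨ ℤ.+-assoc t₀ _ _ ⟨
  t₀ + sum (t ∘ inj₁ ∘ suc) + sum (t ∘ inj₂) ∎
  where
  open ≡-Reasoning
  t₀ = t (inj₁ zero)

-- `remQuot` on `suc m` blocks of length `n` first separates block zero by `splitAt n`, so induction
-- on `m` peels off one block at a time. This turns a sum over the enumeration of `copies` into a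
-- double sum.
sum-remQuot : ∀ m {n} (t : Fin m × Fin n → ℤ) →
              sum (t ∘ remQuot {m} n) ≡ sum (λ i → sum (λ j → t (i , j)))
sum-remQuot zero        t = refl
sum-remQuot (suc m) {n} t = begin
  sum (t ∘ remQuot {suc m} n)
    ≡⟨ sum-cong-≗ (λ i → pull (splitAt n i)) ⟩
  sum (t′ ∘ splitAt n)
    ≡⟨ sum-splitAt n t′ ⟩
  sum (λ j → t (zero , j)) + sum (t ∘ Product.map₁ suc ∘ remQuot {m} n)
    ≡⟨ cong (_+_ (sum (λ j → t (zero , j)))) (sum-remQuot m (t ∘ Product.map₁ suc)) ⟩
  sum (λ i → sum (λ j → t (i , j))) ∎
  where
  open ≡-Reasoning
  t′ : Fin n ⊎ Fin (m ℕ.* n) → ℤ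
  t′ = [ (λ j → t (zero , j)) , t ∘ Product.map₁ suc ∘ remQuot {m} n ]′

  -- `remQuot` is `swap` after `quotRem`, which branches on `splitAt`; abstracting that result as
  -- `s` lets each branch compute.
  pull : ∀ s → t (Product.swap ([ _, zero , Product.map₂ suc ∘ Fin.quotRem {m} n ]′ s)) ≡ t′ s
  pull (inj₁ j) = refl
  pull (inj₂ i) = refl

-- Sums over the vertices of an oriented graph

module _ (G : OrientedGraph) {P : Vertex G → Set} (P? : ∀ y → Dec (P y)) (f : Vertex G → ℤ) where

  sumOver-none : (∀ y → ¬ P y) → sumOver G P? f ≡ 0ℤ
  sumOver-none ¬P = sum-zero _ λ i →
    cong (if_then f (vertex G i) else 0ℤ) (dec-false (P? (vertex G i)) (¬P _))

  -- Serves both for the single in- and out-neighbour on a directed cycle and for the single node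
  -- that balances a vertex of a cycle.
  sumOver-unique : ∀ {y} → P y → (∀ {z} → P z → y ≡ z) → sumOver G P? f ≡ f y
  sumOver-unique {y} Py unique = begin
    sumOver G P? f  ≡⟨ sum-single _ i₀ (λ j j≢i₀ → cong (if_then f (vertex G j) else 0ℤ)
                         (dec-false (P? (vertex G j)) (j≢i₀ ∘ index))) ⟩
    term (vertex G i₀) ≡⟨ cong term (Inverse.strictlyInverseʳ (enumeration G) y) ⟩
    term y             ≡⟨ cong (if_then f y else 0ℤ) (dec-true (P? y) Py) ⟩
    f y                ∎
    where
    open ≡-Reasoning
    i₀ = Inverse.to (enumeration G) y
    term : Vertex G → ℤ
    term z = if does (P? z) then f z else 0ℤ

    index : ∀ {j} → P (vertex G j) → j ≡ i₀
    index {j} p = trans (sym (Inverse.strictlyInverseˡ (enumeration G) j))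
                        (cong (Inverse.to (enumeration G)) (sym (unique p)))

-- The enumeration of a join unfolds to `splitAt` followed by the two given enumerations, so this is
-- an instance of `sum-splitAt`.
sumOver-join : ∀ G H (C : Connection G H) {P : Vertex (join G H C) → Set}
               (P? : ∀ y → Dec (P y)) f →
               sumOver (join G H C) P? f ≡
               sumOver G (P? ∘ inj₁) (f ∘ inj₁) + sumOver H (P? ∘ inj₂) (f ∘ inj₂)
sumOver-join G H C P? f =
  sum-splitAt (order G) λ s →
    let y = Sum.map (vertex G) (vertex H) s in if does (P? y) then f y else 0ℤ

wt-unique : ∀ G f {x y z} → Edge G y x → (∀ {w} → Edge G w x → y ≡ w) →
            Edge G x z → (∀ {w} → Edge G x w → z ≡ w) → wt G f x ≡ f y - f z
wt-unique G f {x} in₁ in₂ out₁ out₂ =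
  cong₂ _-_ (sumOver-unique G (λ y → edge? G y x) f in₁ in₂) (sumOver-unique G (edge? G x) f out₁ out₂)

1≤label : ∀ {G g} → IsStandardLabeling G g → ∀ v → 1ℤ ≤ g v
1≤label std v = proj₁ (Equivalence.to (image std _) (v , refl))

-- Σₓ f(x) wt(x) vanishes because its (x, y) and (y, x) terms cancel.  For a
-- constant weight c it equals c Σₓ f(x).
wt≡0 : ∀ G {f} → IsDDMLabeling G f → ∀ x → wt G f x ≡ 0ℤ
wt≡0 G {f} ddm x = conclude (ℤ.i*j≡0⇒i≡0∨j≡0 (sum F) total)
  where
  open ≡-Reasoning
  c = wt G f x
  F : Fin (order G) → ℤ
  F i = f (vertex G i)
  inflow outflow : Fin (order G) → ℤ
  inflow  i = sumOver G (λ y → edge? G y (vertex G i)) f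
  outflow i = sumOver G (edge? G (vertex G i)) f

  -- The third index selects the endpoint whose label is counted: for an edge from j to i,
  -- `flow j i j` contributes to the inflow of i and `flow j i i` to the outflow of j.
  flow : Fin (order G) → Fin (order G) → Fin (order G) → ℤ
  flow i j k = if does (edge? G (vertex G i) (vertex G j)) then F k else 0ℤ

  exchange : ∀ i j → F i * flow j i j ≡ F j * flow j i i
  exchange i j with does (edge? G (vertex G j) (vertex G i))
  ... | true  = ℤ.*-comm (F i) (F j)
  ... | false = trans (ℤ.*-zeroʳ (F i)) (sym (ℤ.*-zeroʳ (F j)))

  balanced : sum (λ i → F i * inflow i) ≡ sum (λ i → F i * outflow i)
  balanced = begin
    sum (λ i → F i * inflow i)
      ≡⟨ sum-cong-≗ (λ i → *-distribˡ-sum (F i) (λ j → flow j i j)) ⟩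
    sum (λ i → sum (λ j → F i * flow j i j))
      ≡⟨ sum-cong-≗ (λ i → sum-cong-≗ (exchange i)) ⟩
    sum (λ i → sum (λ j → F j * flow j i i))
      ≡⟨ ∑-comm (λ i j → F j * flow j i i) ⟩
    sum (λ j → sum (λ i → F j * flow j i i))
      ≡⟨ sum-cong-≗ (λ j → *-distribˡ-sum (F j) (λ i → flow j i i)) ⟨
    sum (λ i → F i * outflow i) ∎

  total : sum F * c ≡ 0ℤ
  total = ∙-cancelˡ (sum (λ i → F i * outflow i)) _ _ (begin
    sum (λ i → F i * outflow i) + sum F * c
      ≡⟨ cong (_+_ (sum (λ i → F i * outflow i))) (*-distribʳ-sum c F) ⟩
    sum (λ i → F i * outflow i) + sum (λ i → F i * c)
      ≡⟨ ∑-distrib-+ (λ i → F i * outflow i) (λ i → F i * c) ⟨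
    sum (λ i → F i * outflow i + F i * c)
      ≡⟨ sum-cong-≗ (λ i → regroup (F i) (outflow i) (inflow i) c (constant ddm x (vertex G i))) ⟩
    sum (λ i → F i * inflow i)
      ≡⟨ balanced ⟩
    sum (λ i → F i * outflow i)
      ≡⟨ ℤ.+-identityʳ _ ⟨
    sum (λ i → F i * outflow i) + 0ℤ ∎)
    where
    regroup : ∀ a o i c → c ≡ i - o → a * o + a * c ≡ a * i
    regroup a o i _ refl = identity a o i
      where
      identity : ∀ a o i → a * o + a * (i - o) ≡ a * i
      identity = solve-∀

  -- The vertex `x` makes the order positive, so a sum of labels that are all at least 1 cannot
  -- vanish and the factor `c` must.
  nonempty : ∀ {n} → Fin n → (t : Fin n → ℤ) → (∀ i → 1ℤ ≤ t i) → sum t ≢ 0ℤ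
  nonempty {suc n} _ t 1≤t sum≡0 = contradiction (subst (1ℤ ≤_) sum≡0
    (ℤ.+-mono-≤ (1≤t zero) (sum-nonneg (t ∘ suc) (λ i → ℤ.≤-trans (+≤+ z≤n) (1≤t (suc i))))))
    λ { (+≤+ ()) }

  conclude : sum F ≡ 0ℤ ⊎ c ≡ 0ℤ → c ≡ 0ℤ
  conclude (inj₁ sum≡0) = ⊥-elim (nonempty (Inverse.to (enumeration G) x) F (λ i → 1≤label (standard ddm) _) sum≡0)
  conclude (inj₂ c≡0)   = c≡0

-- Weighted sums

+∣i∣≡j⇒i≡±j : ∀ i {j} → + ∣ i ∣ ≡ j → i ≡ j ⊎ i ≡ - j
+∣i∣≡j⇒i≡±j i refl with ℤ.+∣i∣≡i⊎+∣i∣≡-i i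
... | inj₁ e = inj₁ (sym e)
... | inj₂ e = inj₂ (trans (sym (ℤ.neg-involutive i)) (cong -_ (sym e)))

1≤i⇒-i≢1≤j : ∀ {i j} → 1ℤ ≤ i → 1ℤ ≤ j → - i ≢ j
1≤i⇒-i≢1≤j {+[1+ m ]} {+[1+ n ]} _ _ ()
1≤i⇒-i≢1≤j {+ 0} (+≤+ ()) _ _

-- The condition under which `g` and `h` together take exactly the values from 1 to the order of the
-- join.
IsContinuation : (G H : OrientedGraph) → (Vertex H → ℤ) → Set
IsContinuation G H h =
  ∀ k → (∃[ u ] h u ≡ k) ⇔ (+ order G < k × k ≤ + (order G ℕ.+ order H))

module WeightedSum {G : OrientedGraph} {g : Vertex G → ℤ} (ddm : IsDDMLabeling G g)
                   (H : OrientedGraph) {h : Vertex H → ℤ} where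

  private
    std  = standard ddm
    conn = weightConnection G std H h
    S    = join G H conn

  labeling : Vertex G ⊎ Vertex H → ℤ
  labeling = [ g , h ]′

  -- Labels of `G` are positive, so the weights `g v` and `- g v` both have absolute value `g v`.
  -- Nodes can thus be found from absolute weights alone.
  attached⇒ : ∀ {v} u → Attached conn v u → + ∣ wt H h u ∣ ≡ g v
  attached⇒ {v} u (inj₁ e) = begin
    + ∣ wt H h u ∣ ≡⟨ cong (λ i → + ∣ i ∣) e ⟩
    + ∣ - g v ∣    ≡⟨ cong +_ (ℤ.∣-i∣≡∣i∣ (g v)) ⟩
    + ∣ g v ∣      ≡⟨ ℤ.0≤i⇒+∣i∣≡i (ℤ.≤-trans (+≤+ z≤n) (1≤label {G} std v)) ⟩
    g v            ∎
    where open ≡-Reasoning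
  attached⇒ {v} u (inj₂ e) =
    trans (cong (λ i → + ∣ i ∣) e) (ℤ.0≤i⇒+∣i∣≡i (ℤ.≤-trans (+≤+ z≤n) (1≤label {G} std v)))

  attached⇐ : ∀ {v} u → + ∣ wt H h u ∣ ≡ g v → Attached conn v u
  attached⇐ u e = Sum.swap (+∣i∣≡j⇒i≡±j (wt H h u) e)

  module _ (injective-h : IsLabeling H h) (continuation : IsContinuation G H h) where

    -- The values of `g` stay at or below `order G` and those of `h` exceed it. Hence no value is
    -- shared, and comparing `k` with `order G` decides on which side its preimage lies.
    standard-S : IsStandardLabeling S labeling
    standard-S = record
      { injective = λ {x} {y} → inj x y
      ; image     = λ k → mk⇔ (λ { (inj₁ v , refl) → below v ; (inj₂ u , refl) → above u }) onto }
      where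
      g≤n : ∀ v → g v ≤ + order G
      g≤n v = proj₂ (Equivalence.to (image std _) (v , refl))

      n<h : ∀ u → + order G < h u
      n<h u = proj₁ (Equivalence.to (continuation _) (u , refl))

      inj : ∀ x y → labeling x ≡ labeling y → x ≡ y
      inj (inj₁ v) (inj₁ v′) e = cong inj₁ (injective std e)
      inj (inj₂ u) (inj₂ u′) e = cong inj₂ (injective-h e)
      inj (inj₁ v) (inj₂ u)  e = contradiction e (ℤ.<⇒≢ (ℤ.≤-<-trans (g≤n v) (n<h u)))
      inj (inj₂ u) (inj₁ v)  e = contradiction (sym e) (ℤ.<⇒≢ (ℤ.≤-<-trans (g≤n v) (n<h u)))

      below : ∀ v → 1ℤ ≤ g v × g v ≤ + (order G ℕ.+ order H)
      below v = 1≤label {G} std v , ℤ.≤-trans (g≤n v) (+≤+ (ℕ.m≤m+n _ _))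

      above : ∀ u → 1ℤ ≤ h u × h u ≤ + (order G ℕ.+ order H)
      above u = ℤ.i<j⇒suc[i]≤j (ℤ.≤-<-trans (+≤+ z≤n) (n<h u)) ,
                proj₂ (Equivalence.to (continuation _) (u , refl))

      onto : ∀ {k} → 1ℤ ≤ k × k ≤ + (order G ℕ.+ order H) → ∃[ x ] labeling x ≡ k
      onto {k} (1≤k , k≤) with k ℤ.≤? + order G
      ... | yes k≤n = Product.map inj₁ id (Equivalence.from (image std k) (1≤k , k≤n))
      ... | no  k≰n = Product.map inj₂ id (Equivalence.from (continuation k) (ℤ.≰⇒> k≰n , k≤))

    module _ (weights  : WeightsAmongLabels G g H h)
             (balanced : ∀ v → sumOver H (λ u → wt H h u ≟ g v) h ≡
                               sumOver H (λ u → wt H h u ≟ - g v) h) where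

      -- The edges inside `G` contribute `wt G g v`, which is 0; the labels entering `v` from `H`
      -- and those leaving towards `H` cancel by `balanced`.
      wt≡0-G : ∀ v → wt S labeling (inj₁ v) ≡ 0ℤ
      wt≡0-G v = begin
        wt S labeling (inj₁ v)
          ≡⟨ cong₂ _-_ (sumOver-join G H conn (λ y → edge? S y (inj₁ v)) labeling)
                       (sumOver-join G H conn (edge? S (inj₁ v)) labeling) ⟩
        (in-G + in-H) - (out-G + out-H)
          ≡⟨ cong (λ z → (in-G + z) - (out-G + out-H)) (balanced v) ⟩
        (in-G + out-H) - (out-G + out-H)
          ≡⟨ cancel in-G out-G out-H ⟩
        wt G g v
          ≡⟨ wt≡0 G ddm v ⟩
        0ℤ ∎
        where
        open ≡-Reasoning
        in-G  = sumOver G (λ y → edge? G y v) g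
        out-G = sumOver G (edge? G v) g
        in-H  = sumOver H (λ u → wt H h u ≟ g v) h
        out-H = sumOver H (λ u → wt H h u ≟ - g v) h
        cancel : ∀ a b c → (a + c) - (b + c) ≡ a - b
        cancel = solve-∀

      -- A weight i > 0 of `u` in `H` is offset by an edge to the vertex labelled i, a weight -i by
      -- an edge from it. Injectivity of `g` makes that vertex unique, and positivity of labels
      -- excludes edges of the other direction.
      wt≡0-H : ∀ u → wt S labeling (inj₂ u) ≡ 0ℤ
      wt≡0-H u = begin
        wt S labeling (inj₂ u)
          ≡⟨ cong₂ _-_ (sumOver-join G H conn (λ y → edge? S y (inj₂ u)) labeling)
                       (sumOver-join G H conn (edge? S (inj₂ u)) labeling) ⟩
        (to-u + in-H) - (from-u + out-H)
          ≡⟨ regroup to-u in-H from-u out-H ⟩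
        wt H h u + (to-u - from-u)
          ≡⟨ compensated (weights u) ⟩
        0ℤ ∎
        where
        open ≡-Reasoning
        w = wt H h u
        to-u   = sumOver G (λ v → w ≟ - g v) g
        from-u = sumOver G (λ v → w ≟ g v) g
        in-H   = sumOver H (λ y → edge? H y u) h
        out-H  = sumOver H (edge? H u) h

        regroup : ∀ a b c d → (a + b) - (c + d) ≡ (b - d) + (a - c)
        regroup = solve-∀

        signed : ∀ {v} → w ≡ g v ⊎ w ≡ - g v → w + (to-u - from-u) ≡ 0ℤ
        signed {v} (inj₁ e) = begin
          w + (to-u - from-u)
            ≡⟨ cong₂ (λ a b → w + (a - b))
                 (sumOver-none G (λ v → w ≟ - g v) g
                   (λ v′ e′ → 1≤i⇒-i≢1≤j (1≤label {G} std v′) (1≤label {G} std v) (trans (sym e′) e)))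
                 (sumOver-unique G (λ v → w ≟ g v) g e (λ e′ → injective std (trans (sym e) e′))) ⟩
          w + (0ℤ - g v) ≡⟨ cong (λ a → a + (0ℤ - g v)) e ⟩
          g v + (0ℤ - g v) ≡⟨ vanish (g v) ⟩
          0ℤ ∎
          where
          vanish : ∀ a → a + (0ℤ - a) ≡ 0ℤ
          vanish = solve-∀
        signed {v} (inj₂ e) = begin
          w + (to-u - from-u)
            ≡⟨ cong₂ (λ a b → w + (a - b))
                 (sumOver-unique G (λ v → w ≟ - g v) g e
                   (λ e′ → injective std (ℤ.neg-injective (trans (sym e) e′))))
                 (sumOver-none G (λ v → w ≟ g v) g
                   (λ v′ e′ → 1≤i⇒-i≢1≤j (1≤label {G} std v) (1≤label {G} std v′) (trans (sym e) e′))) ⟩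
          w + (g v - 0ℤ) ≡⟨ cong (λ a → a + (g v - 0ℤ)) e ⟩
          - g v + (g v - 0ℤ) ≡⟨ vanish (g v) ⟩
          0ℤ ∎
          where
          vanish : ∀ a → - a + (a - 0ℤ) ≡ 0ℤ
          vanish = solve-∀

        compensated : + ∣ w ∣ ≡ 0ℤ ⊎ ∃[ v ] + ∣ w ∣ ≡ g v → w + (to-u - from-u) ≡ 0ℤ
        compensated (inj₂ (v , e)) = signed (+∣i∣≡j⇒i≡±j w e)
        -- With weight zero `u` has no neighbour in `G`, since labels are at least 1.
        compensated (inj₁ e) = begin
          w + (to-u - from-u)
            ≡⟨ cong₂ (λ a b → w + (a - b))
                 (sumOver-none G (λ v → w ≟ - g v) g (λ v e′ → nonzero v (inj₁ e′)))
                 (sumOver-none G (λ v → w ≟ g v) g (λ v e′ → nonzero v (inj₂ e′))) ⟩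
          w + (0ℤ - 0ℤ) ≡⟨ ℤ.+-identityʳ w ⟩
          w             ≡⟨ ℤ.∣i∣≡0⇒i≡0 (ℤ.+-injective e) ⟩
          0ℤ            ∎
          where
          nonzero : ∀ v → ¬ Attached conn v u
          nonzero v a = contradiction (subst (1ℤ ≤_) (trans (sym (attached⇒ u a)) e) (1≤label {G} std v))
                                      λ { (+≤+ ()) }

      ddm-S : IsDDMLabeling S labeling
      ddm-S = record
        { standard = standard-S
        ; constant = λ x y → trans (wt≡0-S x) (sym (wt≡0-S y)) }
        where
        wt≡0-S : ∀ x → wt S labeling x ≡ 0ℤ
        wt≡0-S (inj₁ v) = wt≡0-G v
        wt≡0-S (inj₂ u) = wt≡0-H u

-- Directed cycles

next-functional : ∀ {L} {x y z : Fin L} → Next x y → Next x z → y ≡ z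
next-functional {y = y} {z} p q = Fin.toℕ-injective (helper p q)
  where
  helper : Next _ y → Next _ z → toℕ y ≡ toℕ z
  helper (inj₁ p)       (inj₁ q)       = trans (sym p) q
  helper (inj₁ p)       (inj₂ (q , _)) = contradiction (trans (sym p) q) (ℕ.<⇒≢ (Fin.toℕ<n y))
  helper (inj₂ (p , _)) (inj₁ q)       = contradiction (trans (sym q) p) (ℕ.<⇒≢ (Fin.toℕ<n z))
  helper (inj₂ (_ , p)) (inj₂ (_ , q)) = trans p (sym q)

next-injective : ∀ {L} {x y z : Fin L} → Next x z → Next y z → x ≡ y
next-injective {x = x} {y} p q = Fin.toℕ-injective (ℕ.suc-injective (helper p q))
  where
  helper : Next x _ → Next y _ → suc (toℕ x) ≡ suc (toℕ y)
  helper (inj₁ p)       (inj₁ q)       = trans p (sym q)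
  helper (inj₁ p)       (inj₂ (_ , q)) = contradiction (trans p q) λ ()
  helper (inj₂ (_ , p)) (inj₁ q)       = contradiction (trans q p) λ ()
  helper (inj₂ (p , _)) (inj₂ (q , _)) = trans p (sym q)

-- Without wrapping, positions strictly increase. Returning after two steps with one wrap forces
-- length 2, with two wraps length 1.
next-asymmetric : ∀ {L} → 3 ℕ.≤ L → {x y : Fin L} → Next x y → ¬ Next y x
next-asymmetric 3≤L {x} {y} (inj₁ p) (inj₁ q) =
  ℕ.<-asym (ℕ.≤-reflexive p) (ℕ.≤-reflexive q)
next-asymmetric 3≤L {x} {y} (inj₁ p) (inj₂ (q , r)) =
  contradiction (subst (3 ℕ.≤_) (trans (sym q) (cong suc (trans (sym p) (cong suc r)))) 3≤L) λ { (s≤s (s≤s ())) }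
next-asymmetric 3≤L {x} {y} (inj₂ (p , r)) (inj₁ q) =
  contradiction (subst (3 ℕ.≤_) (trans (sym p) (cong suc (trans (sym q) (cong suc r)))) 3≤L) λ { (s≤s (s≤s ())) }
next-asymmetric 3≤L {x} {y} (inj₂ (p , _)) (inj₂ (_ , r)) =
  contradiction (subst (3 ℕ.≤_) (trans (sym p) (cong suc r)) 3≤L) λ { (s≤s ()) }

successor : ∀ {L} (x : Fin L) → ∃[ y ] Next x y
successor {suc M} x with suc (toℕ x) ℕ.≟ suc M
... | yes e = zero , inj₂ (e , refl)
... | no ¬e = fromℕ< x<M , inj₁ (sym (Fin.toℕ-fromℕ< x<M))
  where x<M = ℕ.≤∧≢⇒< (Fin.toℕ<n x) ¬e

predecessor : ∀ {L} (x : Fin L) → ∃[ w ] Next w x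
predecessor {suc M} zero    = Fin.fromℕ M , inj₂ (cong suc (Fin.toℕ-fromℕ M) , refl)
predecessor {suc M} (suc x) = Fin.inject₁ x , inj₁ (cong suc (Fin.toℕ-inject₁ x))

-- The flag tells in which direction the cycle is traversed, so that forward and reversed copies are
-- treated uniformly.
Step : ∀ {L} → Bool → Rel (Fin L) _
Step true  x y = Next x y
Step false x y = Next y x

step? : ∀ {L} d (x y : Fin L) → Dec (Step d x y)
step? true  x y = next? x y
step? false x y = next? y x

step-to : ∀ {L} d (x : Fin L) → ∃[ y ] Step d x y
step-to true  = successor
step-to false = predecessor

step-from : ∀ {L} d (x : Fin L) → ∃[ w ] Step d w x
step-from true  = predecessor
step-from false = successor

step-functional : ∀ {L} d {x y z : Fin L} → Step d x y → Step d x z → y ≡ z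
step-functional true  = next-functional
step-functional false = next-injective

step-injective : ∀ {L} d {x y z : Fin L} → Step d x z → Step d y z → x ≡ y
step-injective true  = next-injective
step-injective false = next-functional

-- Positions run from 0 to K + 1: the cycle length is 2 + K.
data Skip (K : ℕ) : ℕ → ℕ → Set where
  inner : ∀ {p} → p ℕ.< K → Skip K p (2 ℕ.+ p)
  wrap₀ : Skip K K 0
  wrap₁ : Skip K (1 ℕ.+ K) 1

-- At most one of the two steps wraps: if both did, the middle vertex would be first and last at
-- once, impossible for length `2 + K`. The weight at `x` compares just the labels of `w` and `y`.
next²⇒skip : ∀ {K} {w x y : Fin (2 ℕ.+ K)} → Next w x → Next x y → Skip K (toℕ w) (toℕ y)
next²⇒skip {K} {w} {x} {y} (inj₁ p) (inj₁ q) =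
  subst (Skip K (toℕ w)) w+2≡y (inner (ℕ.s≤s⁻¹ (ℕ.s≤s⁻¹ (subst (ℕ._< 2 ℕ.+ K) (sym w+2≡y) (Fin.toℕ<n y)))))
  where
  w+2≡y : 2 ℕ.+ toℕ w ≡ toℕ y
  w+2≡y = trans (cong suc p) q
next²⇒skip {K} (inj₁ p) (inj₂ (q , r)) =
  subst₂ (Skip K) (ℕ.suc-injective (trans (sym (ℕ.suc-injective q)) (sym p))) (sym r) wrap₀
next²⇒skip {K} (inj₂ (p , r)) (inj₁ q) =
  subst₂ (Skip K) (sym (ℕ.suc-injective p)) (trans (cong suc (sym r)) q) wrap₁
next²⇒skip (inj₂ (_ , p)) (inj₂ (q , _)) = contradiction (trans (cong suc (sym p)) q) λ ()

-- Supplies the middle vertex, at which a prescribed difference becomes a weight.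
skip⇒next² : ∀ {K p q} → Skip K p q →
             ∃[ w ] ∃[ x ] ∃[ y ] Next {2 ℕ.+ K} w x × Next x y × toℕ w ≡ p × toℕ y ≡ q
skip⇒next² {K} {p} (inner p<K) =
  fromℕ< p<L , fromℕ< 1+p<L , fromℕ< 2+p<L ,
  inj₁ (trans (cong suc (Fin.toℕ-fromℕ< p<L)) (sym (Fin.toℕ-fromℕ< 1+p<L))) ,
  inj₁ (trans (cong suc (Fin.toℕ-fromℕ< 1+p<L)) (sym (Fin.toℕ-fromℕ< 2+p<L))) ,
  Fin.toℕ-fromℕ< p<L , Fin.toℕ-fromℕ< 2+p<L
  where
  2+p<L : 2 ℕ.+ p ℕ.< 2 ℕ.+ K
  2+p<L = s≤s (s≤s p<K)
  1+p<L : 1 ℕ.+ p ℕ.< 2 ℕ.+ K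
  1+p<L = ℕ.<-trans (ℕ.n<1+n _) 2+p<L
  p<L : p ℕ.< 2 ℕ.+ K
  p<L = ℕ.<-trans (ℕ.n<1+n _) 1+p<L
skip⇒next² {K} wrap₀ =
  Fin.inject₁ (Fin.fromℕ K) , Fin.fromℕ (suc K) , zero ,
  inj₁ (cong suc (Fin.toℕ-inject₁ (Fin.fromℕ K))) ,
  inj₂ (cong suc (Fin.toℕ-fromℕ (suc K)) , refl) ,
  trans (Fin.toℕ-inject₁ (Fin.fromℕ K)) (Fin.toℕ-fromℕ K) , refl
skip⇒next² {K} wrap₁ =
  Fin.fromℕ (suc K) , zero , suc zero ,
  inj₂ (cong suc (Fin.toℕ-fromℕ (suc K)) , refl) , inj₁ refl ,
  Fin.toℕ-fromℕ (suc K) , refl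

-- Pigeonhole: if `y` were missed, punching it out would inject `Fin (suc n)` into `Fin n`.
injective⇒surjective : ∀ {n} {f : Fin n → Fin n} → Injective _≡_ _≡_ f → ∀ y → ∃[ x ] f x ≡ y
injective⇒surjective {suc n} {f} inj y with Fin.any? (λ x → f x Fin.≟ y)
... | yes hit = hit
... | no miss = contradiction
  (Fin.injective⇒≤ {f = λ x → Fin.punchOut (y≢f x)} λ e → inj (Fin.punchOut-injective (y≢f _) (y≢f _) e))
  ℕ.1+n≰n
  where
  y≢f : ∀ x → y ≢ f x
  y≢f x e = miss (x , sym e)

-- `entry` lives on all of ℕ so that concrete positions compute, and the left inverse `position`
-- encodes its injectivity. `admissible` and `attained` together say that the differences two apart
-- are exactly the entries of `ℓ`.
record Arrangement (K : ℕ) {s : ℕ} (ℓ : Vec ℤ s) : Set where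
  field
    entry      : ℕ → ℕ
    position   : ℕ → ℕ
    position-entry : ∀ p → position (entry p) ≡ p
    bounded    : ∀ {p} → p ℕ.< 2 ℕ.+ K → entry p ℕ.< 2 ℕ.+ K
    admissible : ∀ {p q} → Skip K p q → ∃[ j ] + ℕ.∣ entry p - entry q ∣ ≡ lookup ℓ j
    attained   : ∀ j → ∃₂ λ p q → Skip K p q × + ℕ.∣ entry p - entry q ∣ ≡ lookup ℓ j

-- The Prouhet–Thue–Morse pattern + − − +: both Σₖ ±1 and Σₖ ±k vanish.
forward : Fin 4 → Bool
forward 0F = true
forward 1F = false
forward 2F = false
forward 3F = true

∣⊖∣≡∣-∣ : ∀ a b → ∣ a ⊖ b ∣ ≡ ℕ.∣ a - b ∣
∣⊖∣≡∣-∣ zero    zero    = refl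
∣⊖∣≡∣-∣ zero    (suc b) = refl
∣⊖∣≡∣-∣ (suc a) zero    = refl
∣⊖∣≡∣-∣ (suc a) (suc b) = trans (cong ∣_∣ (ℤ.[1+m]⊖[1+n]≡m⊖n a b)) (∣⊖∣≡∣-∣ a b)

signed : Bool → ℤ → ℤ
signed true  i = i
signed false i = - i

does-cong : ∀ {A B : Set} (a? : Dec A) (b? : Dec B) → (A → B) → (B → A) → does a? ≡ does b?
does-cong (yes a) b? f g = sym (dec-true b? (f a))
does-cong (no ¬a) b? f g = sym (dec-false b? (¬a ∘ g))

-- Copies 0 and 3 have weight `D`, copies 1 and 2 weight `- D`. Moving the sign across the tests
-- leaves only the booleans for `D ≡ γ` and `D ≡ - γ`. If they agree, the two sums are identical;
-- otherwise the sums are the two sides of the hypothesis on `h`.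
forward-balanced : ∀ D γ (h : Fin 4 → ℤ) → h 0F + h 3F ≡ h 1F + h 2F →
  sum (λ k → if does (signed (forward k) D ≟ γ) then h k else 0ℤ) ≡
  sum (λ k → if does (signed (forward k) D ≟ - γ) then h k else 0ℤ)
forward-balanced D γ h e
  rewrite does-cong (- D ≟ γ) (D ≟ - γ)
            (λ p → trans (sym (ℤ.neg-involutive D)) (cong -_ p))
            (λ p → trans (cong -_ p) (ℤ.neg-involutive γ))
        | does-cong (- D ≟ - γ) (D ≟ γ) ℤ.neg-injective (cong (λ i → - i))
  = cases (does (D ≟ γ)) (does (D ≟ - γ))
  where
  outer : ∀ a d → a + (0ℤ + (0ℤ + (d + 0ℤ))) ≡ a + d
  outer = solve-∀

  inner-terms : ∀ b c → 0ℤ + (b + (c + (0ℤ + 0ℤ))) ≡ b + c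
  inner-terms = solve-∀

  alternating : Bool → Bool → Fin 4 → Bool
  alternating p q k = if forward k then p else q

  cases : ∀ p q →
    sum (λ k → if alternating p q k then h k else 0ℤ) ≡ sum (λ k → if alternating q p k then h k else 0ℤ)
  cases true  true  = refl
  cases false false = refl
  cases true  false = trans (outer (h 0F) (h 3F)) (trans e (sym (inner-terms (h 1F) (h 2F))))
  cases false true  = trans (inner-terms (h 1F) (h 2F)) (trans (sym e) (sym (outer (h 0F) (h 3F))))

-- Four shifted copies of one arranged cycle

module FourCycles {K : ℕ} (3≤2+K : 3 ℕ.≤ 2 ℕ.+ K) {s : ℕ} {ℓ : Vec ℤ s} (A : Arrangement K ℓ) (n : ℕ) where

  open Arrangement A

  private
    L = 2 ℕ.+ K

  orientation : Orientation (copies 4 (cycle L 3≤2+K))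
  orientation = record
    { Arc        = λ (i , x) (j , y) → i ≡ j × Step (forward i) x y
    ; arc?       = λ (i , x) (j , y) → (i Fin.≟ j) ×-dec step? (forward i) x y
    ; arc-asym   = λ { {i , _} (refl , p) (_ , q) → step-asymmetric (forward i) p q }
    ; underlying = λ (i , x) (j , y) → mk⇔
        (λ { (refl , a) → Sum.map (refl ,_) (refl ,_) (orient (forward i) a) })
        (λ { (inj₁ (refl , a)) → refl , unorient (forward i) (inj₁ a)
           ; (inj₂ (refl , a)) → refl , unorient (forward i) (inj₂ a) })
    }
    where
    step-asymmetric : ∀ d {x y : Fin L} → Step d x y → ¬ Step d y x
    step-asymmetric true  p q = next-asymmetric 3≤2+K p q
    step-asymmetric false p q = next-asymmetric 3≤2+K q p

    orient : ∀ d {x y : Fin L} → Next x y ⊎ Next y x → Step d x y ⊎ Step d y x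
    orient true  a = a
    orient false a = Sum.swap a

    unorient : ∀ d {x y : Fin L} → Step d x y ⊎ Step d y x → Next x y ⊎ Next y x
    unorient true  a = a
    unorient false a = Sum.swap a

  H : OrientedGraph
  H = oriented orientation

  consistent : ConsistentlyOriented H
  consistent (i , x) =
    let w , p = step-from (forward i) x
        y , q = step-to (forward i) x
    in ((i , w) , (refl , p) , λ { (refl , p′) → cong (i ,_) (step-injective (forward i) p p′) }) ,
       ((i , y) , (refl , q) , λ { (refl , q′) → cong (i ,_) (step-functional (forward i) q q′) })

  at : Fin L → Fin L
  at x = fromℕ< (bounded (Fin.toℕ<n x))

  toℕ-at : ∀ x → toℕ (at x) ≡ entry (toℕ x)
  toℕ-at x = Fin.toℕ-fromℕ< (bounded (Fin.toℕ<n x))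

  at-injective : Injective _≡_ _≡_ at
  at-injective {x} {y} e = Fin.toℕ-injective (begin
    toℕ x                      ≡⟨ position-entry _ ⟨
    position (entry (toℕ x))   ≡⟨ cong position (toℕ-at x) ⟨
    position (toℕ (at x))      ≡⟨ cong (position ∘ toℕ) e ⟩
    position (toℕ (at y))      ≡⟨ cong position (toℕ-at y) ⟩
    position (entry (toℕ y))   ≡⟨ position-entry _ ⟩
    toℕ y                      ∎)
    where open ≡-Reasoning

  -- `combine` numbers the pairs bijectively from 0, so `suc` and `n` place the labels directly
  -- after 1, ..., n. The form with explicit shifts is `label-affine`.
  label : Vertex H → ℤ
  label (k , x) = + suc (n ℕ.+ toℕ (combine k (at x)))

  label-injective : IsLabeling H label
  label-injective {k , x} {k′ , x′} e =
    let k≡k′ , at≡at′ = Fin.combine-injective k (at x) k′ (at x′)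
          (Fin.toℕ-injective (ℕ.+-cancelˡ-≡ n _ _ (ℕ.suc-injective (ℤ.+-injective e))))
    in cong₂ _,_ k≡k′ (at-injective at≡at′)

  label-image : ∀ k → (∃[ u ] label u ≡ k) ⇔ (+ n < k × k ≤ + (n ℕ.+ order H))
  label-image k = mk⇔
    (λ { ((i , x) , refl) → +<+ (s≤s (ℕ.m≤m+n n _)) ,
                            +≤+ (ℕ.≤-trans (ℕ.≤-reflexive (sym (ℕ.+-suc n _)))
                                           (ℕ.+-monoʳ-≤ n (Fin.toℕ<n (combine i (at x))))) })
    (λ { (+<+ n<m , +≤+ m≤) → onto n<m m≤ })
    where
    onto : ∀ {m} → n ℕ.< m → m ℕ.≤ n ℕ.+ order H → ∃[ u ] label u ≡ + m
    onto {m} n<m m≤ =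
      -- `d` is m - (n + 1), the zero-based index of the label; it is decoded by `combine`, and then
      -- `at` is inverted.
      let d , e             = ℕ.m≤n⇒∃[o]m+o≡n n<m
          d<4L              = ℕ.+-cancelˡ-≤ n (suc d) (order H)
                                (subst (ℕ._≤ n ℕ.+ order H) (trans (sym e) (sym (ℕ.+-suc n d))) m≤)
          i , y , i,y≡d     = Fin.combine-surjective {4} {L} (fromℕ< d<4L)
          x , at-x≡y        = injective⇒surjective at-injective y
      in (i , x) , cong +_ (begin
        suc (n ℕ.+ toℕ (combine i (at x)))  ≡⟨ cong (λ z → suc (n ℕ.+ toℕ (combine i z))) at-x≡y ⟩
        suc (n ℕ.+ toℕ (combine i y))       ≡⟨ cong (λ z → suc (n ℕ.+ toℕ z)) i,y≡d ⟩
        suc (n ℕ.+ toℕ (fromℕ< d<4L))       ≡⟨ cong (λ z → suc (n ℕ.+ z)) (Fin.toℕ-fromℕ< d<4L) ⟩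
        suc (n ℕ.+ d)                       ≡⟨ e ⟩
        m                                   ∎)
      where open ≡-Reasoning

  label-affine : ∀ k x → label (k , x) ≡ + (suc n ℕ.+ L ℕ.* toℕ k ℕ.+ entry (toℕ x))
  label-affine k x = cong (+_ ∘ suc) (begin
    n ℕ.+ toℕ (combine k (at x))           ≡⟨ cong (n ℕ.+_) (Fin.toℕ-combine k (at x)) ⟩
    n ℕ.+ (L ℕ.* toℕ k ℕ.+ toℕ (at x))     ≡⟨ cong (λ z → n ℕ.+ (L ℕ.* toℕ k ℕ.+ z)) (toℕ-at x) ⟩
    n ℕ.+ (L ℕ.* toℕ k ℕ.+ entry (toℕ x))  ≡⟨ ℕ.+-assoc n _ _ ⟨
    n ℕ.+ L ℕ.* toℕ k ℕ.+ entry (toℕ x)    ∎)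
    where open ≡-Reasoning

  label-difference : ∀ k x y → label (k , x) - label (k , y) ≡ entry (toℕ x) ⊖ entry (toℕ y)
  label-difference k x y = begin
    label (k , x) - label (k , y)
      ≡⟨ cong₂ _-_ (label-affine k x) (label-affine k y) ⟩
    + (c ℕ.+ entry (toℕ x)) - + (c ℕ.+ entry (toℕ y))
      ≡⟨ ℤ.m-n≡m⊖n (c ℕ.+ entry (toℕ x)) (c ℕ.+ entry (toℕ y)) ⟩
    (c ℕ.+ entry (toℕ x)) ⊖ (c ℕ.+ entry (toℕ y))
      ≡⟨ ℤ.+-cancelˡ-⊖ c (entry (toℕ x)) (entry (toℕ y)) ⟩
    entry (toℕ x) ⊖ entry (toℕ y) ∎
    where
    open ≡-Reasoning
    c = suc n ℕ.+ L ℕ.* toℕ k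

  -- Reversing a copy exchanges the roles of `w` and `y` and so negates the weight; the shift of the
  -- copy cancels in the difference.
  wt-label : ∀ k {w x y} → Next w x → Next x y →
             wt H label (k , x) ≡ signed (forward k) (entry (toℕ w) ⊖ entry (toℕ y))
  wt-label k {w} {x} {y} p q = trans
    (wt-unique H label (refl , source (forward k))
      (λ { (refl , p′) → cong (k ,_) (step-injective (forward k) (source (forward k)) p′) })
      (refl , target (forward k))
      (λ { (refl , q′) → cong (k ,_) (step-functional (forward k) (target (forward k)) q′) }))
    (difference (forward k))
    where
    source : ∀ d → Step d (if d then w else y) x
    source true  = p
    source false = q

    target : ∀ d → Step d x (if d then y else w)
    target true  = q
    target false = p

    difference : ∀ d → label (k , (if d then w else y)) - label (k , (if d then y else w)) ≡
                       signed d (entry (toℕ w) ⊖ entry (toℕ y))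
    difference true  = label-difference k w y
    difference false = trans (label-difference k y w) (ℤ.⊖-swap (entry (toℕ y)) (entry (toℕ w)))

  ∣wt-label∣ : ∀ k {w x y} → Next w x → Next x y →
               ∣ wt H label (k , x) ∣ ≡ ℕ.∣ entry (toℕ w) - entry (toℕ y) ∣
  ∣wt-label∣ k {w} {x} {y} p q = begin
    ∣ wt H label (k , x) ∣                                  ≡⟨ cong ∣_∣ (wt-label k p q) ⟩
    ∣ signed (forward k) (entry (toℕ w) ⊖ entry (toℕ y)) ∣  ≡⟨ ∣signed∣ (forward k) _ ⟩
    ∣ entry (toℕ w) ⊖ entry (toℕ y) ∣                       ≡⟨ ∣⊖∣≡∣-∣ (entry (toℕ w)) (entry (toℕ y)) ⟩
    ℕ.∣ entry (toℕ w) - entry (toℕ y) ∣                     ∎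
    where
    open ≡-Reasoning
    ∣signed∣ : ∀ d i → ∣ signed d i ∣ ≡ ∣ i ∣
    ∣signed∣ true  i = refl
    ∣signed∣ false i = ℤ.∣-i∣≡∣i∣ i

  weight-listed : ∀ u → ∃[ j ] + ∣ wt H label u ∣ ≡ lookup ℓ j
  weight-listed (k , x) =
    let w , p = predecessor x
        y , q = successor x
        j , e = admissible (next²⇒skip p q)
    in j , trans (cong +_ (∣wt-label∣ k p q)) e

  -- Absolute weights do not depend on the copy, so one position works for every `k`. Its copies are
  -- what makes a listed label the label of a node.
  listed-weight : ∀ j → ∃[ x ] ∀ k → + ∣ wt H label (k , x) ∣ ≡ lookup ℓ j
  listed-weight j =
    let p , q , skip , e          = attained j
        w , x , y , wx , xy , w≡p , y≡q = skip⇒next² skip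
    in x , λ k → trans (cong +_ (trans (∣wt-label∣ k wx xy)
                   (cong₂ (λ a b → ℕ.∣ entry a - entry b ∣) w≡p y≡q))) e

  -- Interchanging the two summations collects the four copies of each position, where
  -- `forward-balanced` applies; its hypothesis on the labels comes from 0 + 3 = 1 + 2 for the
  -- shifts.
  label-balanced : ∀ γ → sumOver H (λ u → wt H label u ≟ γ) label ≡
                         sumOver H (λ u → wt H label u ≟ - γ) label
  label-balanced γ = begin
    sumOver H (λ u → wt H label u ≟ γ) label
      ≡⟨ by-position γ ⟩
    sum (λ x → sum (λ k → if does (signed (forward k) (D x) ≟ γ) then label (k , x) else 0ℤ))
      ≡⟨ sum-cong-≗ (λ x → forward-balanced (D x) γ (λ k → label (k , x)) (thue-morse x)) ⟩
    sum (λ x → sum (λ k → if does (signed (forward k) (D x) ≟ - γ) then label (k , x) else 0ℤ))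
      ≡⟨ by-position (- γ) ⟨
    sumOver H (λ u → wt H label u ≟ - γ) label ∎
    where
    open ≡-Reasoning
    D : Fin L → ℤ
    D x = entry (toℕ (proj₁ (predecessor x))) ⊖ entry (toℕ (proj₁ (successor x)))

    by-position : ∀ δ → sumOver H (λ u → wt H label u ≟ δ) label ≡
      sum (λ x → sum (λ k → if does (signed (forward k) (D x) ≟ δ) then label (k , x) else 0ℤ))
    by-position δ = begin
      sumOver H (λ u → wt H label u ≟ δ) label
        ≡⟨ sum-remQuot 4 (λ u → if does (wt H label u ≟ δ) then label u else 0ℤ) ⟩
      sum (λ k → sum (λ x → if does (wt H label (k , x) ≟ δ) then label (k , x) else 0ℤ))
        ≡⟨ sum-cong-≗ (λ k → sum-cong-≗ (λ x → cong (λ i → if does (i ≟ δ) then label (k , x) else 0ℤ)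
             (wt-label k (proj₂ (predecessor x)) (proj₂ (successor x))))) ⟩
      sum (λ k → sum (λ x → if does (signed (forward k) (D x) ≟ δ) then label (k , x) else 0ℤ))
        ≡⟨ ∑-comm (λ k x → if does (signed (forward k) (D x) ≟ δ) then label (k , x) else 0ℤ) ⟩
      sum (λ x → sum (λ k → if does (signed (forward k) (D x) ≟ δ) then label (k , x) else 0ℤ)) ∎

    thue-morse : ∀ x → label (0F , x) + label (3F , x) ≡ label (1F , x) + label (2F , x)
    thue-morse x = begin
      label (0F , x) + label (3F , x)
        ≡⟨ cong₂ _+_ (label-affine 0F x) (label-affine 3F x) ⟩
      + ((suc n ℕ.+ L ℕ.* 0 ℕ.+ entry (toℕ x)) ℕ.+ (suc n ℕ.+ L ℕ.* 3 ℕ.+ entry (toℕ x)))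
        ≡⟨ cong +_ (identity (suc n) L (entry (toℕ x))) ⟩
      + ((suc n ℕ.+ L ℕ.* 1 ℕ.+ entry (toℕ x)) ℕ.+ (suc n ℕ.+ L ℕ.* 2 ℕ.+ entry (toℕ x)))
        ≡⟨ cong₂ _+_ (label-affine 1F x) (label-affine 2F x) ⟨
      label (1F , x) + label (2F , x) ∎
      where
      identity : ∀ a b c → (a ℕ.+ b ℕ.* 0 ℕ.+ c) ℕ.+ (a ℕ.+ b ℕ.* 3 ℕ.+ c) ≡
                           (a ℕ.+ b ℕ.* 1 ℕ.+ c) ℕ.+ (a ℕ.+ b ℕ.* 2 ℕ.+ c)
      identity = solveℕ-∀

-- From an arrangement to the ornament and the weighted sum

arrangement⇒theorem :
  (G₀ : OrientedGraph) (g : Vertex G₀ → ℤ) (ddm : IsDDMLabeling G₀ g) →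
  {K s : ℕ} (3≤L : 3 ℕ.≤ 2 ℕ.+ K) {ℓ : Vec ℤ (suc s)} → Unique ℓ → Arrangement K ℓ →
  LabelsOccur G₀ g ℓ →
  Σ[ O ∈ Orientation (copies 4 (cycle (2 ℕ.+ K) 3≤L)) ]
  Σ[ h ∈ (Vertex (oriented O) → ℤ) ]
  Σ[ pos ∈ IsPositiveLabeling (oriented O) h ]
    ConsistentlyOriented (oriented O)
    × IsNodesOrnament G₀ g (oriented O) (suc s) ℓ
    × (Σ[ w ∈ WeightsAmongLabels G₀ g (oriented O) h ]
         IsDDMOG (weightedSum G₀ (standard ddm) (oriented O) pos w))
arrangement⇒theorem G₀ g ddm 3≤L {ℓ} unique A occurs =
  orientation , label , (label-injective , λ u → +<+ (s≤s z≤n)) , consistent ,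
  record
    { connection     = conn
    ; attachment     = node 0F , (0F , x₀) , attached 0F 0F
    ; labeling       = labeling
    -- The graph with the ornament attached is the weighted sum itself, so one DDM labeling proves
    -- both claims.
    ; ddm            = ddm′
    ; preserves      = λ v → refl
    ; node           = node
    ; node-injective = λ {i} {j} e → lookup-injective unique i j
                         (trans (sym (node-label i)) (trans (cong g e) (node-label j)))
    ; isNode         = λ v → mk⇔
        -- The absolute weight of a vertex attached to `v` is listed and equals `g v`, so
        -- injectivity of `g` makes `v` one of the chosen nodes.
        (λ (u , _ , _ , a , _) → let j , e = weight-listed u in
           j , injective (standard ddm) (trans (node-label j) (trans (sym e) (attached⇒ u a))))
        -- Copies 0 and 1 of the same position are two distinct vertices attached to this node.
        (λ { (i , refl) → (0F , proj₁ (listed-weight i)) , (1F , proj₁ (listed-weight i)) ,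
                          (λ ()) , attached i 0F , attached i 1F })
    ; node-label     = node-label
    } ,
  weights , labeling , ddm′
  where
  open FourCycles 3≤L A (order G₀)
  open WeightedSum {G₀} ddm H {label}

  conn = weightConnection G₀ (standard ddm) H label
  x₀   = proj₁ (listed-weight 0F)

  node : _ → Vertex G₀
  node j = proj₁ (occurs j)

  node-label : ∀ j → g (node j) ≡ lookup ℓ j
  node-label j = proj₂ (occurs j)

  attached : ∀ j k → Attached conn (node j) (k , proj₁ (listed-weight j))
  attached j k = attached⇐ (k , proj₁ (listed-weight j)) (trans (proj₂ (listed-weight j) k) (sym (node-label j)))

  weights : WeightsAmongLabels G₀ g H label
  weights u = let j , e = weight-listed u in inj₂ (node j , trans e (sym (node-label j)))

  ddm′ = ddm-S label-injective label-image weights (λ v → label-balanced (g v))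

-- Arrangements for the listed labels

∣p-d+p∣≡d : ∀ p d → ℕ.∣ p - d ℕ.+ p ∣ ≡ d
∣p-d+p∣≡d p d = trans (cong (ℕ.∣ p -_∣) (ℕ.+-comm d p)) (ℕ.∣m-m+n∣≡n p d)

-- Two nodes: the natural order

identity-arrangement : ∀ k → Arrangement (suc k) (+ 2 ∷ + suc k ∷ [])
identity-arrangement k = record
  { entry          = id
  ; position       = id
  ; position-entry = λ p → refl
  ; bounded        = id
  -- Interior differences are 2; both wraps give K = `suc k`, which is L - 2.
  ; admissible     = λ { (inner {p} _) → 0F , cong +_ (∣p-d+p∣≡d p 2)
                       ; wrap₀ → 1F , refl
                       ; wrap₁ → 1F , refl }
  ; attained       = λ { 0F → _ , _ , inner (s≤s z≤n) , refl
                       ; 1F → _ , _ , wrap₀ , refl }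
  }

-- For L = 4 the wrap difference L - 2 coincides with the interior difference 2.
identity-arrangement₄ : Arrangement 2 (+ 2 ∷ [])
identity-arrangement₄ = record
  { entry          = id
  ; position       = id
  ; position-entry = λ p → refl
  ; bounded        = id
  ; admissible     = λ { (inner {p} _) → 0F , cong +_ (∣p-d+p∣≡d p 2)
                       ; wrap₀ → 0F , refl
                       ; wrap₁ → 0F , refl }
  ; attained       = λ { 0F → _ , _ , wrap₀ , refl }
  }

-- Three nodes: the even entries 0, 2, ..., 2m - 2 followed by the odd entries 1, 3, ..., 2m - 1

interleave : ℕ → ℕ → ℕ
interleave m p with p ℕ.<? m
... | yes _ = p ℕ.* 2
... | no  _ = suc ((p ℕ.∸ m) ℕ.* 2)

data Half (m : ℕ) : ℕ → Set where
  low  : ∀ {p} → p ℕ.< m → Half m p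
  high : ∀ r → Half m (m ℕ.+ r)

half : ∀ m p → Half m p
half m p with p ℕ.<? m
... | yes p<m = low p<m
... | no  p≮m = let r , e = ℕ.m≤n⇒∃[o]m+o≡n (ℕ.≮⇒≥ p≮m) in subst (Half m) e (high r)

interleave-low : ∀ {m p} → p ℕ.< m → interleave m p ≡ p ℕ.* 2
interleave-low {m} {p} p<m with p ℕ.<? m
... | yes _  = refl
... | no p≮m = contradiction p<m p≮m

interleave-high : ∀ m r → interleave m (m ℕ.+ r) ≡ suc (r ℕ.* 2)
interleave-high m r with (m ℕ.+ r) ℕ.<? m
... | yes m+r<m = contradiction m+r<m (ℕ.m+n≮m m r)
... | no  _     = cong (λ z → suc (z ℕ.* 2)) (ℕ.m+n∸m≡n m r)

-- Lowering a value by 2 keeps its parity and moves one position back; the least even value sits at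
-- position 0, the least odd one at `m`.
interleave⁻¹ : ℕ → ℕ → ℕ
interleave⁻¹ m 0             = 0
interleave⁻¹ m 1             = m
interleave⁻¹ m (suc (suc v)) = suc (interleave⁻¹ m v)

interleave⁻¹-even : ∀ m p → interleave⁻¹ m (p ℕ.* 2) ≡ p
interleave⁻¹-even m zero    = refl
interleave⁻¹-even m (suc p) = cong suc (interleave⁻¹-even m p)

interleave⁻¹-odd : ∀ m r → interleave⁻¹ m (suc (r ℕ.* 2)) ≡ m ℕ.+ r
interleave⁻¹-odd m zero    = sym (ℕ.+-identityʳ m)
interleave⁻¹-odd m (suc r) = trans (cong suc (interleave⁻¹-odd m r)) (sym (ℕ.+-suc m r))

-- Here L = 2m with m = 3 + t. Inside either half the difference is 4. Passing from the evens to the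
-- odds compares 2m - 4 with 1 or 2m - 2 with 3, giving L - 5; wrapping compares 2m - 3 with 0 or 2m
-- - 1 with 2, giving L - 3.
interleave-arrangement : ∀ t → Arrangement (4 ℕ.+ t ℕ.* 2) (+ 4 ∷ + (1 ℕ.+ t ℕ.* 2) ∷ + (3 ℕ.+ t ℕ.* 2) ∷ [])
interleave-arrangement t = record
  { entry          = c
  ; position       = interleave⁻¹ m
  ; position-entry = λ p → inverse (half m p)
  ; bounded        = λ {p} → below (half m p)
  ; admissible     = admissible
  ; attained       = λ
    { 0F → 0 , 2 , inner (s≤s z≤n) , refl
    -- Position 1 + t is m - 2, from which two steps lead to the first odd entry.
    ; 1F → _ , _ , inner {p = 1 ℕ.+ t} (s≤s (s≤s (ℕ.≤-trans (ℕ.m≤m*n t 2) (ℕ.m≤n+m _ 2)))) , cong +_ crossing₁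
    ; 2F → _ , _ , wrap₀ , cong +_ wrapping₀ }
  }
  where
  m = 3 ℕ.+ t
  c = interleave m

  inverse : ∀ {p} → Half m p → interleave⁻¹ m (c p) ≡ p
  inverse {p} (low p<m) = trans (cong (interleave⁻¹ m) (interleave-low p<m)) (interleave⁻¹-even m p)
  inverse (high r)      = trans (cong (interleave⁻¹ m) (interleave-high m r)) (interleave⁻¹-odd m r)

  2m≡m+m : m ℕ.* 2 ≡ m ℕ.+ m
  2m≡m+m = trans (ℕ.*-comm m 2) (cong (m ℕ.+_) (ℕ.+-identityʳ m))

  below : ∀ {p} → Half m p → p ℕ.< m ℕ.* 2 → c p ℕ.< m ℕ.* 2
  below (low p<m) _ = subst (ℕ._< m ℕ.* 2) (sym (interleave-low p<m)) (ℕ.*-monoˡ-< 2 p<m)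
  below (high r)  q = subst (ℕ._< m ℕ.* 2) (sym (interleave-high m r))
    (ℕ.*-monoˡ-≤ 2 (ℕ.+-cancelˡ-< m r m (subst (m ℕ.+ r ℕ.<_) 2m≡m+m q)))

  difference : ∀ p q {a b} → c p ≡ a → c q ≡ b → ℕ.∣ c p - c q ∣ ≡ ℕ.∣ a - b ∣
  difference p q = cong₂ ℕ.∣_-_∣

  crossing₁ : ℕ.∣ c (1 ℕ.+ t) - c (3 ℕ.+ t) ∣ ≡ 1 ℕ.+ t ℕ.* 2
  crossing₁ = difference (1 ℕ.+ t) (3 ℕ.+ t) (interleave-low (ℕ.m≤n+m (2 ℕ.+ t) 1))
    (trans (cong c (sym (ℕ.+-identityʳ m))) (interleave-high m 0))

  crossing₂ : ℕ.∣ c (2 ℕ.+ t) - c (4 ℕ.+ t) ∣ ≡ 1 ℕ.+ t ℕ.* 2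
  crossing₂ = difference (2 ℕ.+ t) (4 ℕ.+ t) (interleave-low (ℕ.n<1+n (2 ℕ.+ t)))
    (trans (cong c (ℕ.+-comm 1 m)) (interleave-high m 1))

  wrapping₀ : ℕ.∣ c (4 ℕ.+ t ℕ.* 2) - c 0 ∣ ≡ 3 ℕ.+ t ℕ.* 2
  wrapping₀ = difference (4 ℕ.+ t ℕ.* 2) 0
    (trans (cong c (split t)) (interleave-high m (1 ℕ.+ t))) refl
    where
    split : ∀ t → 4 ℕ.+ t ℕ.* 2 ≡ 3 ℕ.+ t ℕ.+ (1 ℕ.+ t)
    split = solveℕ-∀

  wrapping₁ : ℕ.∣ c (5 ℕ.+ t ℕ.* 2) - c 1 ∣ ≡ 3 ℕ.+ t ℕ.* 2
  wrapping₁ = difference (5 ℕ.+ t ℕ.* 2) 1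
    (trans (cong c (split t)) (interleave-high m (2 ℕ.+ t))) refl
    where
    split : ∀ t → 5 ℕ.+ t ℕ.* 2 ≡ 3 ℕ.+ t ℕ.+ (2 ℕ.+ t)
    split = solveℕ-∀

  within-low : ∀ {p} → 2 ℕ.+ p ℕ.< m → ℕ.∣ c p - c (2 ℕ.+ p) ∣ ≡ 4
  within-low {p} 2+p<m = trans
    (difference p (2 ℕ.+ p) (interleave-low (ℕ.≤-trans (ℕ.m≤n+m (suc p) 2) 2+p<m)) (interleave-low 2+p<m))
    (∣p-d+p∣≡d (p ℕ.* 2) 4)

  within-high : ∀ r → ℕ.∣ c (m ℕ.+ r) - c (2 ℕ.+ (m ℕ.+ r)) ∣ ≡ 4
  within-high r = trans
    (difference (m ℕ.+ r) (2 ℕ.+ (m ℕ.+ r)) (interleave-high m r)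
      (trans (cong c (shift t r)) (interleave-high m (2 ℕ.+ r))))
    (∣p-d+p∣≡d (r ℕ.* 2) 4)
    where
    shift : ∀ t r → 2 ℕ.+ (3 ℕ.+ t ℕ.+ r) ≡ 3 ℕ.+ t ℕ.+ (2 ℕ.+ r)
    shift = solveℕ-∀

  interior : ∀ {p} → Half m p → ∃[ j ] + ℕ.∣ c p - c (2 ℕ.+ p) ∣ ≡
                     lookup (+ 4 ∷ + (1 ℕ.+ t ℕ.* 2) ∷ + (3 ℕ.+ t ℕ.* 2) ∷ []) j
  interior (high r) = 0F , cong +_ (within-high r)
  -- In the even half, p = m - 1 and p = m - 2 are the two positions whose skip crosses into the odd
  -- half.
  interior {p} (low p<m) with ℕ.m≤n⇒m<n∨m≡n p<m
  ... | inj₂ refl = 1F , cong +_ crossing₂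
  ... | inj₁ 1+p<m with ℕ.m≤n⇒m<n∨m≡n 1+p<m
  ...   | inj₂ refl  = 1F , cong +_ crossing₁
  ...   | inj₁ 2+p<m = 0F , cong +_ (within-low 2+p<m)

  admissible : ∀ {p q} → Skip (4 ℕ.+ t ℕ.* 2) p q → ∃[ j ] + ℕ.∣ c p - c q ∣ ≡
                         lookup (+ 4 ∷ + (1 ℕ.+ t ℕ.* 2) ∷ + (3 ℕ.+ t ℕ.* 2) ∷ []) j
  admissible (inner {p} _) = interior (half m p)
  admissible wrap₀         = 2F , cong +_ wrapping₀
  admissible wrap₁         = 2F , cong +_ wrapping₁

-- Four to six nodes: permuting a few of the first entries

transpose₂₃ : ℕ → ℕ
transpose₂₃ 2 = 3
transpose₂₃ 3 = 2
transpose₂₃ p = p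

transpose₂₃-involutive : ∀ p → transpose₂₃ (transpose₂₃ p) ≡ p
transpose₂₃-involutive 0 = refl
transpose₂₃-involutive 1 = refl
transpose₂₃-involutive 2 = refl
transpose₂₃-involutive 3 = refl
transpose₂₃-involutive (suc (suc (suc (suc p)))) = refl

-- The order 0, 1, 3, 2, 4, 5, ... has initial differences 3, 1, 1, 3 and then 2. Entries 0 and 1
-- stay in place, so both wraps give L - 2. As L = 7 + k, position 4 still has an interior skip,
-- which attains 2.
transpose₂₃-arrangement : ∀ k → Arrangement (5 ℕ.+ k) (+ 1 ∷ + 2 ∷ + 3 ∷ + (5 ℕ.+ k) ∷ [])
transpose₂₃-arrangement k = record
  { entry          = transpose₂₃
  ; position       = transpose₂₃
  ; position-entry = transpose₂₃-involutive
  ; bounded        = below _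
  ; admissible     = λ
    { (inner {0} _) → 2F , refl
    ; (inner {1} _) → 0F , refl
    ; (inner {2} _) → 0F , refl
    ; (inner {3} _) → 2F , refl
    ; (inner {suc (suc (suc (suc p)))} _) → 1F , cong +_ (∣p-d+p∣≡d p 2)
    ; wrap₀ → 3F , refl
    ; wrap₁ → 3F , refl }
  ; attained       = λ
    { 0F → _ , _ , inner {p = 1} (ℕ.m≤m+n 2 _) , refl
    ; 1F → _ , _ , inner {p = 4} (ℕ.m≤m+n 5 _) , refl
    ; 2F → _ , _ , inner {p = 0} (ℕ.m≤m+n 1 _) , refl
    ; 3F → _ , _ , wrap₀ , refl }
  }
  where
  below : ∀ p → p ℕ.< 7 ℕ.+ k → transpose₂₃ p ℕ.< 7 ℕ.+ k
  below 0 lt = lt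
  below 1 lt = lt
  below 2 _  = ℕ.m≤m+n 4 _
  below 3 _  = ℕ.m≤m+n 3 _
  below (suc (suc (suc (suc p)))) lt = lt

transpose₁₂ : ℕ → ℕ
transpose₁₂ 1 = 2
transpose₁₂ 2 = 1
transpose₁₂ p = p

transpose₁₂-involutive : ∀ p → transpose₁₂ (transpose₁₂ p) ≡ p
transpose₁₂-involutive 0 = refl
transpose₁₂-involutive 1 = refl
transpose₁₂-involutive 2 = refl
transpose₁₂-involutive (suc (suc (suc p))) = refl

transpose₁₂-bounded : ∀ k p → p ℕ.< 3 ℕ.+ k → transpose₁₂ p ℕ.< 3 ℕ.+ k
transpose₁₂-bounded k 0 lt = lt
transpose₁₂-bounded k 1 _  = ℕ.m≤m+n 3 _
transpose₁₂-bounded k 2 _  = ℕ.m≤m+n 2 _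
transpose₁₂-bounded k (suc (suc (suc p))) lt = lt

-- For L = 6 the arrangement by transpose₂₃ has no difference 2.
transpose₁₂-arrangement₆ : Arrangement 4 (+ 1 ∷ + 2 ∷ + 3 ∷ + 4 ∷ [])
transpose₁₂-arrangement₆ = record
  { entry          = transpose₁₂
  ; position       = transpose₁₂
  ; position-entry = transpose₁₂-involutive
  ; bounded        = transpose₁₂-bounded 3 _
  ; admissible     = λ
    { (inner {0} _) → 0F , refl
    ; (inner {1} _) → 0F , refl
    ; (inner {2} _) → 2F , refl
    ; (inner {suc (suc (suc p))} _) → 1F , cong +_ (∣p-d+p∣≡d p 2)
    ; wrap₀ → 3F , refl
    ; wrap₁ → 2F , refl }
  ; attained       = λ
    { 0F → _ , _ , inner {p = 0} (ℕ.m≤m+n 1 _) , refl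
    ; 1F → _ , _ , inner {p = 3} (ℕ.m≤m+n 4 _) , refl
    ; 2F → _ , _ , wrap₁ , refl
    ; 3F → _ , _ , wrap₀ , refl }
  }

-- The order 0, 2, 1, 3, 4, ... has initial differences 1, 1, 3 and then 2. Since 2 now follows 0,
-- the wrap to position 1 gives L - 3 while the wrap to 0 still gives L - 2.
transpose₁₂-arrangement : ∀ k →
  Arrangement (5 ℕ.+ k) (+ 1 ∷ + 2 ∷ + 3 ∷ + (4 ℕ.+ k) ∷ + (5 ℕ.+ k) ∷ [])
transpose₁₂-arrangement k = record
  { entry          = transpose₁₂
  ; position       = transpose₁₂
  ; position-entry = transpose₁₂-involutive
  ; bounded        = transpose₁₂-bounded (4 ℕ.+ k) _
  ; admissible     = λ
    { (inner {0} _) → 0F , refl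
    ; (inner {1} _) → 0F , refl
    ; (inner {2} _) → 2F , refl
    ; (inner {suc (suc (suc p))} _) → 1F , cong +_ (∣p-d+p∣≡d p 2)
    ; wrap₀ → 4F , refl
    ; wrap₁ → 3F , refl }
  ; attained       = λ
    { 0F → _ , _ , inner {p = 0} (ℕ.m≤m+n 1 _) , refl
    ; 1F → _ , _ , inner {p = 3} (ℕ.m≤m+n 4 _) , refl
    ; 2F → _ , _ , inner {p = 2} (ℕ.m≤m+n 3 _) , refl
    ; 3F → _ , _ , wrap₁ , refl
    ; 4F → _ , _ , wrap₀ , refl }
  }

rotate₁₂₃ : ℕ → ℕ
rotate₁₂₃ 1 = 2
rotate₁₂₃ 2 = 3
rotate₁₂₃ 3 = 1
rotate₁₂₃ p = p

rotate₁₂₃-cubed : ∀ p → rotate₁₂₃ (rotate₁₂₃ (rotate₁₂₃ p)) ≡ p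
rotate₁₂₃-cubed 0 = refl
rotate₁₂₃-cubed 1 = refl
rotate₁₂₃-cubed 2 = refl
rotate₁₂₃-cubed 3 = refl
rotate₁₂₃-cubed (suc (suc (suc (suc p)))) = refl

-- The order 0, 2, 3, 1, 4, 5, ... has initial differences 3, 1, 1, 4 and then 2; the wraps give L -
-- 2 and, to the entry 2 at position 1, L - 3.
rotate₁₂₃-arrangement : ∀ k →
  Arrangement (6 ℕ.+ k) (+ 1 ∷ + 2 ∷ + 3 ∷ + 4 ∷ + (5 ℕ.+ k) ∷ + (6 ℕ.+ k) ∷ [])
rotate₁₂₃-arrangement k = record
  { entry          = rotate₁₂₃
  -- A 3-cycle is inverted by its square.
  ; position       = rotate₁₂₃ ∘ rotate₁₂₃
  ; position-entry = rotate₁₂₃-cubed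
  ; bounded        = below _
  ; admissible     = λ
    { (inner {0} _) → 2F , refl
    ; (inner {1} _) → 0F , refl
    ; (inner {2} _) → 0F , refl
    ; (inner {3} _) → 3F , refl
    ; (inner {suc (suc (suc (suc p)))} _) → 1F , cong +_ (∣p-d+p∣≡d p 2)
    ; wrap₀ → 5F , refl
    ; wrap₁ → 4F , refl }
  ; attained       = λ
    { 0F → _ , _ , inner {p = 1} (ℕ.m≤m+n 2 _) , refl
    ; 1F → _ , _ , inner {p = 4} (ℕ.m≤m+n 5 _) , refl
    ; 2F → _ , _ , inner {p = 0} (ℕ.m≤m+n 1 _) , refl
    ; 3F → _ , _ , inner {p = 3} (ℕ.m≤m+n 4 _) , refl
    ; 4F → _ , _ , wrap₁ , refl
    ; 5F → _ , _ , wrap₀ , refl }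
  }
  where
  below : ∀ p → p ℕ.< 8 ℕ.+ k → rotate₁₂₃ p ℕ.< 8 ℕ.+ k
  below 0 lt = lt
  below 1 _  = ℕ.m≤m+n 3 _
  below 2 _  = ℕ.m≤m+n 4 _
  below 3 _  = ℕ.m≤m+n 2 _
  below (suc (suc (suc (suc p)))) lt = lt

-- Choice of the arrangement for each family of parameters

theorem2p1 : (G₀ : OrientedGraph) (g : Vertex G₀ → ℤ) (ddm : IsDDMLabeling G₀ g) →
    (s L : ℕ) (ℓ : Vec ℤ s) (params : Parameters (order G₀) L s ℓ) →
    LabelsOccur G₀ g ℓ →
    Σ[ O ∈ Orientation (copies 4 (cycle L (3≤L params))) ]
    Σ[ h ∈ (Vertex (oriented O) → ℤ) ]
    Σ[ pos ∈ IsPositiveLabeling (oriented O) h ]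
    ConsistentlyOriented (oriented O)
    × IsNodesOrnament G₀ g (oriented O) s ℓ
    × (Σ[ w ∈ WeightsAmongLabels G₀ g (oriented O) h ]
    IsDDMOG (weightedSum G₀ (IsDDMLabeling.standard ddm) (oriented O) pos w))
-- Matching on the lower bound exposes L as `3 + k`, so that the label `+ L - + 2` computes to
-- `+ suc k`. The families of four, five and six nodes are unfolded in the same way.
theorem2p1 G₀ g ddm _ _ _ params@(two (s≤s (s≤s (s≤s (z≤n {k})))) _ L≢4) =
  arrangement⇒theorem G₀ g ddm (3≤L params) distinct (identity-arrangement k)
  where
  distinct : Unique (+ 2 ∷ + suc k ∷ [])
  distinct = ((λ e → L≢4 (cong (2 ℕ.+_) (sym (ℤ.+-injective e)))) ∷ []) ∷ [] ∷ []
theorem2p1 G₀ g ddm _ _ _ params@(two₄ refl _) =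
  arrangement⇒theorem G₀ g ddm (3≤L params) ([] ∷ []) identity-arrangement₄
-- An even L that is at least 6 has half at least 3; the halves 0, 1 and 2 contradict the bound.
theorem2p1 G₀ g ddm _ _ _ (three () _ (divides 0 refl))
theorem2p1 G₀ g ddm _ _ _ (three (s≤s (s≤s ())) _ (divides 1 refl))
theorem2p1 G₀ g ddm _ _ _ (three (s≤s (s≤s (s≤s (s≤s ())))) _ (divides 2 refl))
theorem2p1 G₀ g ddm _ _ _ params@(three _ _ (divides (suc (suc (suc t))) refl)) =
  arrangement⇒theorem G₀ g ddm (3≤L params) distinct (interleave-arrangement t)
  where
  -- The label 4 is even whereas L - 5 and L - 3 are odd.
  parity : ∀ t a → suc (t ℕ.* 2) ≢ a ℕ.* 2
  parity (suc t) (suc a) e = parity t a (ℕ.suc-injective (ℕ.suc-injective e))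
  parity zero    (suc a) ()
  parity zero    zero    ()
  parity (suc t) zero    ()

  distinct : Unique (+ 4 ∷ + (1 ℕ.+ t ℕ.* 2) ∷ + (3 ℕ.+ t ℕ.* 2) ∷ [])
  distinct = ((λ e → parity t 2 (sym (ℤ.+-injective e))) ∷ (λ e → parity (suc t) 2 (sym (ℤ.+-injective e))) ∷ [])
           ∷ ((λ e → ℕ.m≢1+n+m _ {1} (ℤ.+-injective e)) ∷ [])
           ∷ [] ∷ []
theorem2p1 G₀ g ddm _ _ _ params@(four (s≤s (s≤s (s≤s (s≤s (s≤s (s≤s (z≤n {zero}))))))) _) =
  arrangement⇒theorem G₀ g ddm (3≤L params) distinct transpose₁₂-arrangement₆
  where
  distinct : Unique (+ 1 ∷ + 2 ∷ + 3 ∷ + 4 ∷ [])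
  distinct = ((λ ()) ∷ (λ ()) ∷ (λ ()) ∷ []) ∷ ((λ ()) ∷ (λ ()) ∷ []) ∷ ((λ ()) ∷ []) ∷ [] ∷ []
theorem2p1 G₀ g ddm _ _ _ params@(four (s≤s (s≤s (s≤s (s≤s (s≤s (s≤s (z≤n {suc k}))))))) _) =
  arrangement⇒theorem G₀ g ddm (3≤L params) distinct (transpose₂₃-arrangement k)
  where
  distinct : Unique (+ 1 ∷ + 2 ∷ + 3 ∷ + (5 ℕ.+ k) ∷ [])
  distinct = ((λ ()) ∷ (λ ()) ∷ (λ ()) ∷ []) ∷ ((λ ()) ∷ (λ ()) ∷ []) ∷ ((λ ()) ∷ []) ∷ [] ∷ []
theorem2p1 G₀ g ddm _ _ _ params@(five (s≤s (s≤s (s≤s (s≤s (s≤s (s≤s (s≤s (z≤n {k})))))))) _) =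
  arrangement⇒theorem G₀ g ddm (3≤L params) distinct (transpose₁₂-arrangement k)
  where
  distinct : Unique (+ 1 ∷ + 2 ∷ + 3 ∷ + (4 ℕ.+ k) ∷ + (5 ℕ.+ k) ∷ [])
  distinct = ((λ ()) ∷ (λ ()) ∷ (λ ()) ∷ (λ ()) ∷ []) ∷ ((λ ()) ∷ (λ ()) ∷ (λ ()) ∷ [])
           ∷ ((λ ()) ∷ (λ ()) ∷ []) ∷ ((λ ()) ∷ []) ∷ [] ∷ []
theorem2p1 G₀ g ddm _ _ _ params@(six (s≤s (s≤s (s≤s (s≤s (s≤s (s≤s (s≤s (s≤s (z≤n {k}))))))))) _) =
  arrangement⇒theorem G₀ g ddm (3≤L params) distinct (rotate₁₂₃-arrangement k)
  where
  distinct : Unique (+ 1 ∷ + 2 ∷ + 3 ∷ + 4 ∷ + (5 ℕ.+ k) ∷ + (6 ℕ.+ k) ∷ [])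
  distinct = ((λ ()) ∷ (λ ()) ∷ (λ ()) ∷ (λ ()) ∷ (λ ()) ∷ []) ∷ ((λ ()) ∷ (λ ()) ∷ (λ ()) ∷ (λ ()) ∷ [])
           ∷ ((λ ()) ∷ (λ ()) ∷ (λ ()) ∷ []) ∷ ((λ ()) ∷ (λ ()) ∷ []) ∷ ((λ ()) ∷ []) ∷ [] ∷ []
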